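{- For every $k\ge 3$ and every point $(x_1,\ldots,x_k)$ of the $k$-simplex, $$d_k(x_1,\ldots,x_k)\le\begin{cases}C_k(x_1,x_2) & \text{if } x_i\le 6/11 \text{ for all } i>2,\\ C_3(x_1,x_2) & \text{if there exists } i>2 \text{ with } x_i\ge 6/11.\end{cases}$$
   Context: The $k$-simplex is $\{x\in\mathbb{R}^k: x\ge 0,\ \sum_i x_i=1\}$. Let $F(z)=\min\{(11/6)z,1\}$ for $z\in[0,1]$, and let $F'(z)=11/6$ for $z\in[0,6/11]$ and $F'(z)=0$ otherwise. For a point $(x_1,\dots,x_k)$ of the $k$-simplex define $$d_k(x_1,\ldots,x_k)=\frac{1}{k!}\sum_{\sigma}\Big(F'(x_1)\prod_{i:\sigma(i)<\sigma(1)}[1-F(x_i)]+F'(x_2)\prod_{i:\sigma(i)<\sigma(2)}[1-F(x_i)]\Big),$$ the sum being over all permutations $\sigma$ of $\{1,\dots,k\}$. For $k\ge 3$ and $x_1,x_2\ge0$ with $x_1+x_2\le1$ define $C_k(x_1,x_2)=d_k(x_1,x_2,c,\ldots,c)$ where $c=(1-x_1-x_2)/(k-2)$. -}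

module Defs where

open import Level using (_⊔_) renaming (suc to lsuc)
open import Algebra.Bundles using (CommutativeRing)
open import Algebra.Structures using (IsCommutativeRing)
open import Data.Bool.Base using (if_then_else_)
open import Data.Fin.Base using (Fin; zero; suc; punchIn)
open import Data.Fin.Properties using (_<?_; punchIn-injective)
open import Data.Fin.Permutation using (Permutation′; _⟨$⟩ʳ_; insert; remove; insert-remove; insert-punchIn) renaming (_≈_ to _≈ₚ_; id to idₚ)
open import Data.List.Base using (List; [_]; map; foldr; allFin; cartesianProductWith)
open import Data.List.Membership.Propositional.Properties using (∈-allFin)
open import Data.List.Relation.Unary.Any using (here)
open import Data.List.Relation.Unary.Unique.Propositional.Properties using (allFin⁺)
open import Data.List.Relation.Unary.AllPairs using ([]; _∷_)
open import Data.List.Relation.Unary.All using ([])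
open import Data.Nat.Base using (ℕ; zero; suc; _!) renaming (_+_ to _ℕ+_)
open import Data.Product.Base using (_×_; _,_)
open import Data.Vec.Functional using (Vector; replicate) renaming (_∷_ to _∷ᵛ_)
open import Relation.Binary.Bundles using (Setoid; DecTotalOrder)
open import Relation.Binary.Core using (Rel)
open import Relation.Binary.PropositionalEquality using (_≡_; refl; sym; trans; cong; setoid)
open import Relation.Binary.Structures using (IsDecTotalOrder)
open import Relation.Nullary using (¬_; does)
open import Relation.Nullary.Decidable using (_×-dec_)
import Algebra.Construct.NaturalChoice.Min as Min
import Algebra.Definitions.RawMonoid as RawMonoidDefs
import Data.List.Membership.Setoid as Membership
import Data.List.Membership.Setoid.Properties as Membershipₚ
import Data.List.Relation.Unary.Unique.Setoid as Uniqueness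
import Data.List.Relation.Unary.Unique.Setoid.Properties as Uniquenessₚ

-- A (classical) ordered field.  The real numbers are the intended instance; no
-- completeness is demanded, so the rationals are an instance as well.  The order
-- is decidable because the step function F′ below is defined by a case
-- distinction on it.  The inverse is total, its value at 0# is unspecified.
record OrderedField c ℓ₁ ℓ₂ : Set (lsuc (c ⊔ ℓ₁ ⊔ ℓ₂)) where
  infix  8 _⁻¹ -_
  infixl 7 _*_ _/_
  infixl 6 _+_ _-_
  infix  4 _≈_ _≤_
  field
    Carrier           : Set c
    _≈_               : Rel Carrier ℓ₁
    _≤_               : Rel Carrier ℓ₂
    _+_ _*_           : Carrier → Carrier → Carrier
    -_ _⁻¹            : Carrier → Carrier
    0# 1#             : Carrier
    isCommutativeRing : IsCommutativeRing _≈_ _+_ _*_ -_ 0# 1#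
    0≉1               : ¬ 0# ≈ 1#
    ⁻¹-cong           : ∀ {x y} → x ≈ y → x ⁻¹ ≈ y ⁻¹
    ⁻¹-inverseʳ       : ∀ x → ¬ x ≈ 0# → x * x ⁻¹ ≈ 1#
    isDecTotalOrder   : IsDecTotalOrder _≈_ _≤_
    +-monoˡ-≤         : ∀ z {x y} → x ≤ y → x + z ≤ y + z
    *-nonNeg          : ∀ {x y} → 0# ≤ x → 0# ≤ y → 0# ≤ x * y

  commutativeRing : CommutativeRing c ℓ₁
  commutativeRing = record { isCommutativeRing = isCommutativeRing }

  decTotalOrder : DecTotalOrder c ℓ₁ ℓ₂
  decTotalOrder = record { isDecTotalOrder = isDecTotalOrder }

  open IsDecTotalOrder isDecTotalOrder public using (_≤?_)

  open Min (DecTotalOrder.totalOrder decTotalOrder) public using (_⊓_)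

  open RawMonoidDefs (CommutativeRing.+-rawMonoid commutativeRing) public
    using () renaming (sum to ∑; _×_ to _·_)
  open RawMonoidDefs (CommutativeRing.*-rawMonoid commutativeRing) public
    using () renaming (sum to ∏)

  _-_ _/_ : Carrier → Carrier → Carrier
  x - y = x + (- y)
  x / y = x * y ⁻¹

  fromℕ : ℕ → Carrier
  fromℕ n = n · 1#

permutationSetoid : ℕ → Setoid _ _
permutationSetoid n = record
  { Carrier       = Permutation′ n
  ; _≈_           = _≈ₚ_
  ; isEquivalence = record
    { refl  = λ _ → refl
    ; sym   = λ p i → sym (p i)
    ; trans = λ p q i → trans (p i) (q i)
    }
  }

-- `insert zero j π` is the permutation with 0 ↦ j that otherwise looks like π.
permutations : ∀ n → List (Permutation′ n)
permutations zero    = [ idₚ ]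
permutations (suc n) = cartesianProductWith (insert zero) (allFin (suc n)) (permutations n)

module _ {n : ℕ} where
  open Membership (permutationSetoid n) public using () renaming (_∈_ to _∈ₚ_)
  open Uniqueness (permutationSetoid n) public using () renaming (Unique to Uniqueₚ)

private
  insert-cong : ∀ {n} {i j : Fin (suc n)} {π ρ : Permutation′ n} →
                i ≡ j → π ≈ₚ ρ → insert zero i π ≈ₚ insert zero j ρ
  insert-cong         i≡j π≈ρ zero    = i≡j
  insert-cong {suc _} {i} {_} {π} {ρ} refl π≈ρ (suc k) =
    trans (insert-punchIn zero i π k)
      (trans (cong (punchIn i) (π≈ρ k)) (sym (insert-punchIn zero i ρ k)))

  insert-injective : ∀ {n} {i j : Fin (suc n)} {π ρ : Permutation′ n} →
                     insert zero i π ≈ₚ insert zero j ρ → i ≡ j × π ≈ₚ ρ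
  insert-injective {n} {i} {j} {π} {ρ} eq = eq zero , λ k → go (eq zero) k
    where
    go : i ≡ j → π ≈ₚ ρ
    go refl k = punchIn-injective i _ _
      (trans (sym (insert-punchIn zero i π k)) (trans (eq (suc k)) (insert-punchIn zero i ρ k)))

-- `permutations n` lists every permutation of Fin n exactly once.
permutations-complete : ∀ {n} (π : Permutation′ n) → π ∈ₚ permutations n
permutations-complete {zero}  π = here λ ()
permutations-complete {suc n} π =
  Membershipₚ.∈-resp-≈ (permutationSetoid (suc n))
    {x = insert zero (π ⟨$⟩ʳ zero) (remove zero π)} {y = π} (insert-remove zero π)
    (Membershipₚ.∈-cartesianProductWith⁺
      (setoid (Fin (suc n))) (permutationSetoid n) (permutationSetoid (suc n))
      (λ {i} {j} {σ} {ρ} → insert-cong {π = σ} {ρ = ρ})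
      (∈-allFin (π ⟨$⟩ʳ zero)) (permutations-complete (remove zero π)))

permutations-unique : ∀ n → Uniqueₚ (permutations n)
permutations-unique zero    = [] ∷ []
permutations-unique (suc n) =
  Uniquenessₚ.cartesianProductWith⁺
    (setoid (Fin (suc n))) (permutationSetoid n) (permutationSetoid (suc n))
    (insert zero) (λ {_} {_} {σ} {ρ} → insert-injective {π = σ} {ρ = ρ})
    (allFin⁺ (suc n)) (permutations-unique n)

module Simplex {c ℓ₁ ℓ₂} (K : OrderedField c ℓ₁ ℓ₂) where
  open OrderedField K

  6/11 11/6 : Carrier
  6/11 = fromℕ 6 / fromℕ 11
  11/6 = fromℕ 11 / fromℕ 6

  InSimplex : ∀ {k} → Vector Carrier k → Set _
  InSimplex x = (∀ i → 0# ≤ x i) × ∑ x ≈ 1#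

  F : Carrier → Carrier
  F z = (11/6 * z) ⊓ 1#

  F′ : Carrier → Carrier
  F′ z = if does ((0# ≤? z) ×-dec (z ≤? 6/11)) then 11/6 else 0#

  -- The product of 1 - F(xᵢ) over those i with σ(i) < σ(j).
  ∏Before : ∀ {k} → Permutation′ k → Fin k → Vector Carrier k → Carrier
  ∏Before σ j x =
    ∏ λ i → if does ((σ ⟨$⟩ʳ i) <? (σ ⟨$⟩ʳ j)) then 1# - F (x i) else 1#

  ∑Permutations : ∀ k → (Permutation′ k → Carrier) → Carrier
  ∑Permutations k f = foldr _+_ 0# (map f (permutations k))

  -- Indices are shifted by one: the distinguished coordinates x₁ and x₂ are
  -- x zero and x (suc zero), and the xᵢ with i > 2 are the x (suc (suc i)).
  d : ∀ {n} → Vector Carrier (2 ℕ+ n) → Carrier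
  d {n} x = (1# / fromℕ (k !)) * ∑Permutations k λ σ →
      F′ (x zero)       * ∏Before σ zero       x
    + F′ (x (suc zero)) * ∏Before σ (suc zero) x
    where
    k = 2 ℕ+ n

  -- C m is the function Cₖ for k = 3 + m, so C 0 is C₃.
  C : ℕ → Carrier → Carrier → Carrier
  C m x₁ x₂ = d (x₁ ∷ᵛ x₂ ∷ᵛ replicate (1 ℕ+ m) c′)
    where
    c′ = (1# - x₁ - x₂) / fromℕ (1 ℕ+ m)

{-# OPTIONS --safe #-}
-- Write yᵢ = 1 - F(xᵢ) for i > 2 and n = k - 2.  Sorting the permutations by the
-- positions of the two distinguished coordinates turns both halves of d into
-- nonnegative combinations of the sums S p y = ∑_π ∏_{π(i) < p} yᵢ over the
-- permutations π of the other n coordinates, so it suffices to bound S p y.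
-- Removing one coordinate gives
--   S p (y₀ ∷ y) = p y₀ S (p - 1) y + (n - p) S p y      (n the length of y₀ ∷ y).
-- If all xᵢ ≤ 6/11, then F is linear on them, so ∑ y depends on x₁ and x₂ only, and
-- induction with the tangent line inequality for z ↦ zᵖ yields S p y ≤ n! mᵖ with m
-- the mean of y, with equality for constant y.  If some xᵢ ≥ 6/11, then yᵢ = 0 and
-- S p y ≤ (n - 1)! (n - p), with equality in the case k = 3.
module Submission where

open import Defs
open import Algebra.Bundles using (CommutativeRing)
open import Data.Bool.Base using (true; false; if_then_else_)
open import Data.Empty using (⊥-elim)
open import Data.Fin.Base using (Fin; zero; suc; toℕ; punchIn)
open import Data.Fin.Permutation using (Permutation′; _⟨$⟩ʳ_; insert; insert-punchIn)
open import Data.Fin.Properties using (toℕ≤pred[n])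
open import Data.List.Base using (List; []; _∷_; _++_; map; foldr; tabulate; cartesianProductWith)
open import Data.List.Properties using (map-∘)
open import Data.Nat.Base as ℕ using (ℕ; zero; suc; _∸_; _!; _<ᵇ_) renaming (_+_ to _ℕ+_)
import Data.Nat.Properties as ℕ
open import Data.Product.Base using (_×_; _,_; ∃; proj₁; proj₂)
open import Data.Sum.Base using (inj₁; inj₂; [_,_]′)
open import Data.Vec.Functional using (Vector; tail; replicate) renaming (_∷_ to _∷ᵛ_)
open import Function.Base using (_∘_)
open import Relation.Binary.Bundles using (DecTotalOrder)
open import Relation.Binary.PropositionalEquality as ≡ using (_≡_)
open import Relation.Nullary using (¬_; does)
open import Relation.Nullary.Decidable using (_×-dec_)
import Algebra.Construct.NaturalChoice.Min as Min
import Algebra.Construct.NaturalChoice.MinOp as MinOp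
import Algebra.Properties.CommutativeMonoid.Sum as Sum
import Algebra.Properties.Ring as RingProperties
import Algebra.Properties.Semiring.Exp as Exp
import Algebra.Properties.Semiring.Mult as Mult
import Algebra.Properties.Semiring.Sum as SemiringSum
import Algebra.Solver.Ring.NaturalCoefficients.Default as SemiringSolver
import Relation.Binary.Reasoning.PartialOrder as PartialOrderReasoning

-- Positions after inserting one value into a permutation.

-- Values of the smaller permutation are relabelled by `punchIn j` to make room for `j`. If `j`
-- itself lies below `p`, it uses up one place there, so the threshold for the old values drops by
-- one; otherwise it stays.
punchIn-<ᵇ : ∀ {n} (j : Fin (suc n)) (k : Fin n) p →
             (toℕ (punchIn j k) <ᵇ p) ≡ (toℕ k <ᵇ (if toℕ j <ᵇ p then ℕ.pred p else p))
punchIn-<ᵇ zero    k       zero          = ≡.refl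
punchIn-<ᵇ zero    k       (suc p)       = ≡.refl
punchIn-<ᵇ (suc j) k       zero          = ≡.refl
punchIn-<ᵇ (suc j) zero    (suc zero)    = ≡.refl
punchIn-<ᵇ (suc j) zero    (suc (suc p)) with toℕ j <ᵇ suc p
... | true  = ≡.refl
... | false = ≡.refl
punchIn-<ᵇ (suc j) (suc k) (suc p)       = ≡.trans (punchIn-<ᵇ j k p) (lemma p)
  where
  lemma : ∀ p → (toℕ k <ᵇ (if toℕ j <ᵇ p then ℕ.pred p else p)) ≡
                (suc (toℕ k) <ᵇ (if toℕ j <ᵇ p then p else suc p))
  lemma zero    = ≡.refl
  lemma (suc p) with toℕ j <ᵇ suc p
  ... | true  = ≡.refl
  ... | false = ≡.refl

<ᵇ-irrefl : ∀ n → (n <ᵇ n) ≡ false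
<ᵇ-irrefl zero    = ≡.refl
<ᵇ-irrefl (suc n) = <ᵇ-irrefl n

-- Values from `j` on are pushed up past `j`, smaller ones stay put. The `suc` on the right turns
-- `j ≤ i` into a strict comparison, the form that `∑-threshold` counts.
<ᵇ-punchIn : ∀ {n} (j : Fin (suc n)) (i : Fin n) →
             (toℕ j <ᵇ toℕ (punchIn j i)) ≡ (toℕ j <ᵇ suc (toℕ i))
<ᵇ-punchIn zero    i       = ≡.refl
<ᵇ-punchIn (suc j) zero    = ≡.refl
<ᵇ-punchIn (suc j) (suc i) = <ᵇ-punchIn j i

-- Removing the value `j` undoes the shift made by inserting it, so a threshold placed at the
-- pushed-up `i` returns to `i`.
lower-punchIn : ∀ {n} (j : Fin (suc n)) (i : Fin n) →
                (if toℕ j <ᵇ toℕ (punchIn j i) then ℕ.pred (toℕ (punchIn j i)) else toℕ (punchIn j i)) ≡ toℕ i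
lower-punchIn zero    i       = ≡.refl
lower-punchIn (suc j) zero    = ≡.refl
lower-punchIn (suc j) (suc i) = ≡.trans (lemma (punchIn j i)) (≡.cong suc (lower-punchIn j i))
  where
  lemma : ∀ {m} (k : Fin m) → (if toℕ j <ᵇ toℕ k then toℕ k else suc (toℕ k)) ≡
              suc (if toℕ j <ᵇ toℕ k then ℕ.pred (toℕ k) else toℕ k)
  lemma zero    = ≡.refl
  lemma (suc k) with toℕ j <ᵇ suc (toℕ k)
  ... | true  = ≡.refl
  ... | false = ≡.refl

-- Arithmetic of ordered fields and inequalities for powers.

module OrderedFieldProperties {c ℓ₁ ℓ₂} (K : OrderedField c ℓ₁ ℓ₂) where
  open OrderedField K public
  open CommutativeRing commutativeRing public
    using ( refl; sym; trans; reflexive; commutativeSemiring; semiring; ring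
          ; *-commutativeMonoid
          ; +-cong; +-congˡ; +-congʳ; +-assoc; +-comm; +-identityˡ; +-identityʳ; -‿cong; -‿inverseʳ
          ; *-cong; *-congˡ; *-congʳ; *-assoc; *-comm; *-identityˡ; *-identityʳ; zeroˡ; zeroʳ
          ; distribˡ; distribʳ )
  open RingProperties ring public using (-‿distribʳ-*; -‿involutive; +-cancelʳ)
  open Exp semiring public using (_^_)
  open Mult semiring public using (×-homo-+; ×1-homo-*)
  open DecTotalOrder decTotalOrder public
    using (total; antisym; poset; totalOrder; ≤-respˡ-≈; ≤-respʳ-≈)
    renaming (refl to ≤-refl; trans to ≤-trans; reflexive to ≤-reflexive)
  open PartialOrderReasoning poset public
  open SemiringSolver commutativeSemiring public using (Polynomial; solve; _:+_; _:*_; _:=_; con)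

  -- Unlike con k, this evaluates definitionally to fromℕ k.
  lit : ∀ {n} → ℕ → Polynomial n
  lit zero    = con 0
  lit (suc k) = con 1 :+ lit k

  x+y-x≈y : ∀ x y → x + (y - x) ≈ y
  x+y-x≈y x y = begin-equality
    x + (y - x)   ≈⟨ solve 3 (λ x y z → x :+ (y :+ z) := y :+ (x :+ z)) refl x y (- x) ⟩
    y + (x + - x) ≈⟨ +-congˡ (-‿inverseʳ x) ⟩
    y + 0#        ≈⟨ +-identityʳ y ⟩
    y             ∎

  y+x-x≈y : ∀ x y → (y + x) - x ≈ y
  y+x-x≈y x y = trans (+-assoc y x (- x)) (trans (+-congˡ (-‿inverseʳ x)) (+-identityʳ y))

  +-monoʳ-≤ : ∀ z {x y} → x ≤ y → z + x ≤ z + y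
  +-monoʳ-≤ z {x} {y} x≤y = begin
    z + x ≈⟨ +-comm z x ⟩
    x + z ≤⟨ +-monoˡ-≤ z x≤y ⟩
    y + z ≈⟨ +-comm y z ⟩
    z + y ∎

  +-mono-≤ : ∀ {x y u v} → x ≤ y → u ≤ v → x + u ≤ y + v
  +-mono-≤ {y = y} {u} x≤y u≤v = ≤-trans (+-monoˡ-≤ u x≤y) (+-monoʳ-≤ y u≤v)

  +-cancelʳ-≤ : ∀ z {x y} → x + z ≤ y + z → x ≤ y
  +-cancelʳ-≤ z {x} {y} le = begin
    x           ≈⟨ y+x-x≈y z x ⟨
    (x + z) - z ≤⟨ +-monoˡ-≤ (- z) le ⟩
    (y + z) - z ≈⟨ y+x-x≈y z y ⟩
    y           ∎

  +-nonNeg : ∀ {x y} → 0# ≤ x → 0# ≤ y → 0# ≤ x + y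
  +-nonNeg 0≤x 0≤y = ≤-respˡ-≈ (+-identityʳ 0#) (+-mono-≤ 0≤x 0≤y)

  x≤y⇒0≤y-x : ∀ {x y} → x ≤ y → 0# ≤ y - x
  x≤y⇒0≤y-x {x} x≤y = ≤-respˡ-≈ (-‿inverseʳ x) (+-monoˡ-≤ (- x) x≤y)

  0≤x⇒y≤y+x : ∀ {x} y → 0# ≤ x → y ≤ y + x
  0≤x⇒y≤y+x y 0≤x = ≤-respˡ-≈ (+-identityʳ y) (+-monoʳ-≤ y 0≤x)

  0≤x⇒y-x≤y : ∀ {x} y → 0# ≤ x → y - x ≤ y
  0≤x⇒y-x≤y {x} y 0≤x = ≤-respʳ-≈ (trans (+-comm _ x) (x+y-x≈y x y)) (0≤x⇒y≤y+x (y - x) 0≤x)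

  *-monoˡ-≤ : ∀ {z x y} → 0# ≤ z → x ≤ y → z * x ≤ z * y
  *-monoˡ-≤ {z} {x} {y} 0≤z x≤y = begin
    z * x               ≤⟨ 0≤x⇒y≤y+x (z * x) (*-nonNeg 0≤z (x≤y⇒0≤y-x x≤y)) ⟩
    z * x + z * (y - x) ≈⟨ distribˡ z x (y - x) ⟨
    z * (x + (y - x))   ≈⟨ *-congˡ (x+y-x≈y x y) ⟩
    z * y               ∎

  *-monoʳ-≤ : ∀ {z x y} → 0# ≤ z → x ≤ y → x * z ≤ y * z
  *-monoʳ-≤ {z} {x} {y} 0≤z x≤y = begin
    x * z ≈⟨ *-comm x z ⟩
    z * x ≤⟨ *-monoˡ-≤ 0≤z x≤y ⟩
    z * y ≈⟨ *-comm z y ⟩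
    y * z ∎

  -- Otherwise -1 is nonnegative, and so is its square 1.
  0≤1 : 0# ≤ 1#
  0≤1 with total 0# 1#
  ... | inj₁ 0≤1 = 0≤1
  ... | inj₂ 1≤0 = begin
    0#            ≤⟨ *-nonNeg 0≤-1 0≤-1 ⟩
    - 1# * - 1#   ≈⟨ -‿distribʳ-* (- 1#) 1# ⟨
    - (- 1# * 1#) ≈⟨ -‿cong (*-identityʳ (- 1#)) ⟩
    - - 1#        ≈⟨ -‿involutive 1# ⟩
    1#            ∎
    where
    0≤-1 : 0# ≤ - 1#
    0≤-1 = ≤-respʳ-≈ (+-identityˡ (- 1#)) (x≤y⇒0≤y-x 1≤0)

  ^-nonNeg : ∀ {x} → 0# ≤ x → ∀ n → 0# ≤ x ^ n
  ^-nonNeg 0≤x zero    = 0≤1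
  ^-nonNeg 0≤x (suc n) = *-nonNeg 0≤x (^-nonNeg 0≤x n)

  2xy≤x²+y² : ∀ x y → x * y + x * y ≤ x * x + y * y
  2xy≤x²+y² x y = [ ordered , (λ y≤x → begin
    x * y + x * y ≈⟨ +-cong (*-comm x y) (*-comm x y) ⟩
    y * x + y * x ≤⟨ ordered y≤x ⟩
    y * y + x * x ≈⟨ +-comm (y * y) (x * x) ⟩
    x * x + y * y ∎) ]′ (total x y)
    where
    ordered : ∀ {x y} → x ≤ y → x * y + x * y ≤ x * x + y * y
    -- The two sides differ by the square of `z = y - x`. Products are known to be nonnegative only
    -- for nonnegative factors, hence the case distinction on the order of `x` and `y`.
    ordered {x} {y} x≤y = begin
      x * y + x * y                     ≈⟨ +-cong (*-congˡ y≈x+z) (*-congˡ y≈x+z) ⟩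
      x * (x + z) + x * (x + z)         ≤⟨ 0≤x⇒y≤y+x _ (*-nonNeg 0≤z 0≤z) ⟩
      x * (x + z) + x * (x + z) + z * z ≈⟨ solve 2 (λ x z → x :* (x :+ z) :+ x :* (x :+ z) :+ z :* z
                                                         := x :* x :+ (x :+ z) :* (x :+ z)) refl x z ⟩
      x * x + (x + z) * (x + z)         ≈⟨ +-congˡ (*-cong y≈x+z y≈x+z) ⟨
      x * x + y * y                     ∎
      where
      z = y - x
      0≤z = x≤y⇒0≤y-x x≤y
      y≈x+z = sym (x+y-x≈y x y)

  fromℕ-nonNeg : ∀ n → 0# ≤ fromℕ n
  fromℕ-nonNeg zero    = ≤-refl
  fromℕ-nonNeg (suc n) = +-nonNeg 0≤1 (fromℕ-nonNeg n)

  fromℕ≉0 : ∀ n .{{_ : ℕ.NonZero n}} → ¬ fromℕ n ≈ 0#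
  fromℕ≉0 (suc n) 1+n≈0 = 0≉1 (antisym 0≤1 (≤-respʳ-≈ 1+n≈0 (0≤x⇒y≤y+x 1# (fromℕ-nonNeg n))))

  -- In the recurrence `S-suc` the coefficient `suc n ∸ p` vanishes at `p = suc n`, exactly where
  -- the shorter tail has no induction hypothesis. The inequality is therefore demanded only for
  -- `t ≢ 0`.
  fromℕ-*-mono-≤ : ∀ t {x y} → (t ≡.≢ 0 → x ≤ y) → fromℕ t * x ≤ fromℕ t * y
  fromℕ-*-mono-≤ zero    {x} {y} _ = ≤-reflexive (trans (zeroˡ x) (sym (zeroˡ y)))
  fromℕ-*-mono-≤ (suc t) x≤y       = *-monoˡ-≤ (fromℕ-nonNeg (suc t)) (x≤y λ ())

  ⁻¹-nonNeg : ∀ {x} → 0# ≤ x → ¬ x ≈ 0# → 0# ≤ x ⁻¹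
  ⁻¹-nonNeg {x} 0≤x x≉0 with total 0# (x ⁻¹)
  ... | inj₁ 0≤x⁻¹ = 0≤x⁻¹
  ... | inj₂ x⁻¹≤0 = ⊥-elim (0≉1 (antisym 0≤1 (begin
    1#       ≈⟨ ⁻¹-inverseʳ x x≉0 ⟨
    x * x ⁻¹ ≤⟨ *-monoˡ-≤ 0≤x x⁻¹≤0 ⟩
    x * 0#   ≈⟨ zeroʳ x ⟩
    0#       ∎)))

  x*[y/x]≈y : ∀ {x} y → ¬ x ≈ 0# → x * (y / x) ≈ y
  x*[y/x]≈y {x} y x≉0 = begin-equality
    x * (y * x ⁻¹) ≈⟨ solve 3 (λ x y z → x :* (y :* z) := y :* (x :* z)) refl x y (x ⁻¹) ⟩
    y * (x * x ⁻¹) ≈⟨ *-congˡ (⁻¹-inverseʳ x x≉0) ⟩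
    y * 1#         ≈⟨ *-identityʳ y ⟩
    y              ∎

  *-cancelˡ-≤ : ∀ {z x y} → 0# ≤ z → ¬ z ≈ 0# → z * x ≤ z * y → x ≤ y
  *-cancelˡ-≤ {z} {x} {y} 0≤z z≉0 zx≤zy = begin
    x              ≈⟨ cancel x ⟨
    z ⁻¹ * (z * x) ≤⟨ *-monoˡ-≤ (⁻¹-nonNeg 0≤z z≉0) zx≤zy ⟩
    z ⁻¹ * (z * y) ≈⟨ cancel y ⟩
    y              ∎
    where
    cancel : ∀ w → z ⁻¹ * (z * w) ≈ w
    cancel w = trans (solve 3 (λ z w z⁻¹ → z⁻¹ :* (z :* w) := z :* (w :* z⁻¹)) refl z w (z ⁻¹)) (x*[y/x]≈y w z≉0)

  -- Serves to compare densities with different numbers of coordinates, whose normalisations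
  -- `1 / k!` differ: cross-multiplication removes both inverses.
  reciprocal-*-mono-≤ : ∀ {p q x y} → 0# ≤ p → ¬ p ≈ 0# → 0# ≤ q → ¬ q ≈ 0# →
                        q * x ≤ p * y → (1# / p) * x ≤ (1# / q) * y
  reciprocal-*-mono-≤ {p} {q} {x} {y} 0≤p p≉0 0≤q q≉0 qx≤py =
    *-cancelˡ-≤ 0≤p p≉0 (*-cancelˡ-≤ 0≤q q≉0 (begin
      q * (p * ((1# / p) * x)) ≈⟨ *-congˡ (*-assoc p (1# / p) x) ⟨
      q * (p * (1# / p) * x)   ≈⟨ *-congˡ (*-congʳ (x*[y/x]≈y 1# p≉0)) ⟩
      q * (1# * x)             ≈⟨ *-congˡ (*-identityˡ x) ⟩
      q * x                    ≤⟨ qx≤py ⟩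
      p * y                    ≈⟨ *-congˡ (*-identityˡ y) ⟨
      p * (1# * y)             ≈⟨ *-congˡ (*-congʳ (x*[y/x]≈y 1# q≉0)) ⟨
      p * (q * (1# / q) * y)   ≈⟨ solve 4 (λ p q r y → p :* (q :* r :* y) := q :* (p :* (r :* y))) refl p q (1# / q) y ⟩
      q * (p * ((1# / q) * y)) ∎))

  -- The tangent line of y ↦ yᵖ⁺¹ at m lies below the graph, freed of subtraction.
  ^-tangent-≤ : ∀ {m y} → 0# ≤ m → 0# ≤ y → ∀ p →
                fromℕ (suc p) * (m ^ p * y) ≤ y ^ suc p + fromℕ p * m ^ suc p
  ^-tangent-≤ {m} {y} 0≤m 0≤y zero = ≤-reflexive
    (solve 2 (λ m y → (con 1 :+ con 0) :* (con 1 :* y) := y :* con 1 :+ con 0 :* (m :* con 1)) refl m y)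
  -- The added term completes the left side to `(1 + p) mᵖ` times `2my`, ready for `2xy≤x²+y²`. It
  -- reappears on the right when the induction hypothesis is multiplied by `y`.
  ^-tangent-≤ {m} {y} 0≤m 0≤y (suc p) = +-cancelʳ-≤ (P * (m * A) * y) (begin
    (1# + (1# + P)) * ((m * A) * y) + P * (m * A) * y ≈⟨ solve 4 (λ m y P A →
        (con 1 :+ (con 1 :+ P)) :* ((m :* A) :* y) :+ P :* (m :* A) :* y :=
        (con 1 :+ P) :* A :* (m :* y :+ m :* y)) refl m y P A ⟩
    (1# + P) * A * (m * y + m * y) ≤⟨ *-monoˡ-≤ (*-nonNeg (fromℕ-nonNeg (suc p)) (^-nonNeg 0≤m p)) (2xy≤x²+y² m y) ⟩
    (1# + P) * A * (m * m + y * y) ≈⟨ solve 4 (λ m y P A →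
        (con 1 :+ P) :* A :* (m :* m :+ y :* y) :=
        y :* ((con 1 :+ P) :* (A :* y)) :+ (con 1 :+ P) :* (m :* (m :* A))) refl m y P A ⟩
    y * ((1# + P) * (A * y)) + (1# + P) * (m * (m * A)) ≤⟨ +-monoˡ-≤ _ (*-monoˡ-≤ 0≤y (^-tangent-≤ 0≤m 0≤y p)) ⟩
    y * (Y + P * (m * A)) + (1# + P) * (m * (m * A)) ≈⟨ solve 5 (λ m y P A Y →
        y :* (Y :+ P :* (m :* A)) :+ (con 1 :+ P) :* (m :* (m :* A)) :=
        y :* Y :+ (con 1 :+ P) :* (m :* (m :* A)) :+ P :* (m :* A) :* y) refl m y P A Y ⟩
    y * Y + (1# + P) * (m * (m * A)) + P * (m * A) * y ∎)
    where
    P = fromℕ p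
    A = m ^ p
    Y = y ^ suc p

  fromℕ-∸ : ∀ {p n} → p ℕ.≤ n → fromℕ n ≈ fromℕ p + fromℕ (n ∸ p)
  fromℕ-∸ {p} {n} p≤n = trans (reflexive (≡.cong fromℕ (≡.sym (ℕ.m+[n∸m]≡n p≤n)))) (×-homo-+ 1# p (n ∸ p))

  -- This is the tangent inequality with y₀ eliminated through the hypothesis on the means.
  mean-step-≤ : ∀ {n p y₀ m m′} → p ℕ.≤ suc n → 0# ≤ m → 0# ≤ m′ →
                y₀ + fromℕ n * m′ ≈ fromℕ (suc n) * m →
                fromℕ p * (y₀ * m′ ^ ℕ.pred p) + fromℕ (suc n ∸ p) * m′ ^ p ≤ fromℕ (suc n) * m ^ p
  mean-step-≤ {n} {zero} {y₀} _ _ _ _ = ≤-reflexive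
    (solve 2 (λ N y → con 0 :* (y :* con 1) :+ N :* con 1 := N :* con 1) refl (fromℕ (suc n)) y₀)
  -- Since `n = q + (n - q)`, the added term completes the left side to `(1 + q) m′^q (y₀ + n m′)`,
  -- which `means` turns into `(1 + q) m′^q (n + 1) m`. The tangent is then taken at `m′` and
  -- evaluated at `m`.
  mean-step-≤ {n} {suc q} {y₀} {m} {m′} (ℕ.s≤s q≤n) 0≤m 0≤m′ means = +-cancelʳ-≤ ((1# + (Q + T)) * (Q * (m′ * A))) (begin
    (1# + Q) * (y₀ * A) + T * (m′ * A) + (1# + (Q + T)) * (Q * (m′ * A)) ≈⟨ solve 5 (λ Q T y m A →
        (con 1 :+ Q) :* (y :* A) :+ T :* (m :* A) :+ (con 1 :+ (Q :+ T)) :* (Q :* (m :* A)) :=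
        (con 1 :+ Q) :* A :* (y :+ (Q :+ T) :* m)) refl Q T y₀ m′ A ⟩
    (1# + Q) * A * (y₀ + (Q + T) * m′)               ≈⟨ *-congˡ (+-congˡ (*-congʳ n≈)) ⟨
    (1# + Q) * A * (y₀ + fromℕ n * m′)               ≈⟨ *-congˡ means ⟩
    (1# + Q) * A * ((1# + fromℕ n) * m)              ≈⟨ solve 4 (λ Q N m A →
        (con 1 :+ Q) :* A :* ((con 1 :+ N) :* m) := (con 1 :+ N) :* ((con 1 :+ Q) :* (A :* m))) refl Q (fromℕ n) m A ⟩
    (1# + fromℕ n) * ((1# + Q) * (A * m))            ≤⟨ *-monoˡ-≤ (fromℕ-nonNeg (suc n)) (^-tangent-≤ 0≤m′ 0≤m q) ⟩
    (1# + fromℕ n) * (m ^ suc q + Q * (m′ * A))      ≈⟨ distribˡ _ _ _ ⟩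
    (1# + fromℕ n) * m ^ suc q + (1# + fromℕ n) * (Q * (m′ * A)) ≈⟨ +-congˡ (*-congʳ (+-congˡ n≈)) ⟩
    (1# + fromℕ n) * m ^ suc q + (1# + (Q + T)) * (Q * (m′ * A)) ∎)
    where
    Q = fromℕ q
    T = fromℕ (n ∸ q)
    A = m′ ^ q
    n≈ : fromℕ n ≈ Q + T
    n≈ = fromℕ-∸ q≤n

-- Sums over permutations.

module PermutationSums {c ℓ₁ ℓ₂} (K : OrderedField c ℓ₁ ℓ₂) where
  open OrderedFieldProperties K
  open Simplex K
  open SemiringSum semiring using (sum-cong-≋; sum-replicate-zero)
  open Sum *-commutativeMonoid using () renaming (sum-cong-≋ to ∏-cong)

  ∑-mono-≤ : ∀ {n} {f g : Vector Carrier n} → (∀ i → f i ≤ g i) → ∑ f ≤ ∑ g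
  ∑-mono-≤ {zero}  f≤g = ≤-refl
  ∑-mono-≤ {suc n} f≤g = +-mono-≤ (f≤g zero) (∑-mono-≤ (f≤g ∘ suc))

  ∑-nonNeg : ∀ {n} {f : Vector Carrier n} → (∀ i → 0# ≤ f i) → 0# ≤ ∑ f
  ∑-nonNeg {n} 0≤f = ≤-respˡ-≈ (sum-replicate-zero n) (∑-mono-≤ 0≤f)

  ∑-replicate : ∀ n x → ∑ (replicate n x) ≈ fromℕ n * x
  ∑-replicate zero    x = sym (zeroˡ x)
  ∑-replicate (suc n) x = begin-equality
    x + ∑ (replicate n x)  ≈⟨ +-cong (sym (*-identityˡ x)) (∑-replicate n x) ⟩
    1# * x + fromℕ n * x   ≈⟨ distribʳ x 1# (fromℕ n) ⟨
    (1# + fromℕ n) * x     ∎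

  ∑-dropLast : ∀ n (f : ℕ → Carrier) → f n ≈ 0# → ∑ {suc n} (f ∘ toℕ) ≈ ∑ {n} (f ∘ toℕ)
  ∑-dropLast zero    f fn≈0 = trans (+-identityʳ (f 0)) fn≈0
  ∑-dropLast (suc n) f fn≈0 = +-congˡ (∑-dropLast n (f ∘ suc) fn≈0)

  ∑-threshold : ∀ {p n} a b → p ℕ.≤ n →
                ∑ {n} (λ j → if toℕ j <ᵇ p then a else b) ≈ fromℕ p * a + fromℕ (n ∸ p) * b
  ∑-threshold {zero}  {n} a b _ = begin-equality
    ∑ (replicate n b)           ≈⟨ ∑-replicate n b ⟩
    fromℕ n * b                 ≈⟨ solve 2 (λ a x → x := con 0 :* a :+ x) refl a (fromℕ n * b) ⟩
    0# * a + fromℕ n * b        ∎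
  ∑-threshold {suc p} {suc n} a b (ℕ.s≤s p≤n) = begin-equality
    a + ∑ {n} (λ j → if toℕ j <ᵇ p then a else b) ≈⟨ +-congˡ (∑-threshold a b p≤n) ⟩
    a + (fromℕ p * a + fromℕ (n ∸ p) * b)         ≈⟨ solve 3 (λ a P x →
      a :+ (P :* a :+ x) := (con 1 :+ P) :* a :+ x) refl a (fromℕ p) (fromℕ (n ∸ p) * b) ⟩
    (1# + fromℕ p) * a + fromℕ (n ∸ p) * b        ∎

  -- At the list `permutations n` this is definitionally `∑Permutations n`, so the rules below apply
  -- to it directly.
  ∑ᴸ : ∀ {a} {A : Set a} → (A → Carrier) → List A → Carrier
  ∑ᴸ f xs = foldr _+_ 0# (map f xs)

  module _ {a} {A : Set a} where

    ∑ᴸ-cong : ∀ {f g : A → Carrier} → (∀ x → f x ≈ g x) → ∀ xs → ∑ᴸ f xs ≈ ∑ᴸ g xs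
    ∑ᴸ-cong f≈g []       = refl
    ∑ᴸ-cong f≈g (x ∷ xs) = +-cong (f≈g x) (∑ᴸ-cong f≈g xs)

    ∑ᴸ-nonNeg : ∀ {f : A → Carrier} → (∀ x → 0# ≤ f x) → ∀ xs → 0# ≤ ∑ᴸ f xs
    ∑ᴸ-nonNeg 0≤f []       = ≤-refl
    ∑ᴸ-nonNeg 0≤f (x ∷ xs) = +-nonNeg (0≤f x) (∑ᴸ-nonNeg 0≤f xs)

    ∑ᴸ-*ˡ : ∀ c (f : A → Carrier) xs → ∑ᴸ (λ x → c * f x) xs ≈ c * ∑ᴸ f xs
    ∑ᴸ-*ˡ c f []       = sym (zeroʳ c)
    ∑ᴸ-*ˡ c f (x ∷ xs) = trans (+-congˡ (∑ᴸ-*ˡ c f xs)) (sym (distribˡ c (f x) (∑ᴸ f xs)))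

    ∑ᴸ-+ : ∀ (f g : A → Carrier) xs → ∑ᴸ (λ x → f x + g x) xs ≈ ∑ᴸ f xs + ∑ᴸ g xs
    ∑ᴸ-+ f g []       = sym (+-identityʳ 0#)
    ∑ᴸ-+ f g (x ∷ xs) = trans (+-congˡ (∑ᴸ-+ f g xs))
      (solve 4 (λ a b c d → a :+ b :+ (c :+ d) := a :+ c :+ (b :+ d)) refl (f x) (g x) (∑ᴸ f xs) (∑ᴸ g xs))

    ∑ᴸ-++ : ∀ (f : A → Carrier) xs ys → ∑ᴸ f (xs ++ ys) ≈ ∑ᴸ f xs + ∑ᴸ f ys
    ∑ᴸ-++ f []       ys = sym (+-identityˡ (∑ᴸ f ys))
    ∑ᴸ-++ f (x ∷ xs) ys = trans (+-congˡ (∑ᴸ-++ f xs ys)) (sym (+-assoc (f x) (∑ᴸ f xs) (∑ᴸ f ys)))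

  -- The first list is `tabulate h` for arbitrary `h`, as the induction passes to `h ∘ suc`;
  -- `allFin` is the case of the identity.
  ∑ᴸ-cartesianProductWith : ∀ {a b c} {A : Set a} {B : Set b} {C : Set c} {n}
    (g : C → Carrier) (f : A → B → C) (h : Fin n → A) ys →
    ∑ᴸ g (cartesianProductWith f (tabulate h) ys) ≈ ∑ λ j → ∑ᴸ (g ∘ f (h j)) ys
  ∑ᴸ-cartesianProductWith {n = zero}  g f h ys = refl
  ∑ᴸ-cartesianProductWith {n = suc n} g f h ys = begin-equality
    ∑ᴸ g (map (f (h zero)) ys ++ rest)                       ≈⟨ ∑ᴸ-++ g (map (f (h zero)) ys) rest ⟩
    ∑ᴸ g (map (f (h zero)) ys) + ∑ᴸ g rest                   ≈⟨ +-cong (reflexive (≡.cong (foldr _+_ 0#) (≡.sym (map-∘ ys))))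
                                                                  (∑ᴸ-cartesianProductWith g f (h ∘ suc) ys) ⟩
    ∑ᴸ (g ∘ f (h zero)) ys + (∑ λ j → ∑ᴸ (g ∘ f (h (suc j))) ys) ∎
    where
    rest = cartesianProductWith f (tabulate (h ∘ suc)) ys

  ∑Permutations-suc : ∀ n (f : Permutation′ (suc n) → Carrier) →
    ∑Permutations (suc n) f ≈ ∑ λ j → ∑Permutations n (f ∘ insert zero j)
  ∑Permutations-suc n f = ∑ᴸ-cartesianProductWith f (insert zero) (λ j → j) (permutations n)

  -- Unlike in `∏Before`, the threshold is a number and thus survives the removal of coordinates.
  -- `∏Before σ j x` is definitionally the case `p = toℕ (σ ⟨$⟩ʳ j)` with factors `1# - F (x i)`.
  ∏Below : ∀ {n} → Permutation′ n → ℕ → Vector Carrier n → Carrier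
  ∏Below π p y = ∏ λ i → if toℕ (π ⟨$⟩ʳ i) <ᵇ p then y i else 1#

  -- Equals p! (n - p)! eₚ(y) for p ≤ n, with eₚ the elementary symmetric polynomial.
  S : ∀ {n} → ℕ → Vector Carrier n → Carrier
  S {n} p y = ∑Permutations n λ π → ∏Below π p y

  ∏Below-nonNeg : ∀ {n} (π : Permutation′ n) p {y : Vector Carrier n} → (∀ i → 0# ≤ y i) → 0# ≤ ∏Below π p y
  ∏Below-nonNeg π p 0≤y = ∏-nonNeg λ i → factor (toℕ (π ⟨$⟩ʳ i) <ᵇ p) (0≤y i)
    where
    factor : ∀ b {x} → 0# ≤ x → 0# ≤ (if b then x else 1#)
    factor true  0≤x = 0≤x
    factor false _   = 0≤1
    ∏-nonNeg : ∀ {n} {f : Vector Carrier n} → (∀ i → 0# ≤ f i) → 0# ≤ ∏ f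
    ∏-nonNeg {zero}  _   = 0≤1
    ∏-nonNeg {suc n} 0≤f = *-nonNeg (0≤f zero) (∏-nonNeg (0≤f ∘ suc))

  S-nonNeg : ∀ {n} p {y : Vector Carrier n} → (∀ i → 0# ≤ y i) → 0# ≤ S p y
  S-nonNeg {n} p 0≤y = ∑ᴸ-nonNeg (λ π → ∏Below-nonNeg π p 0≤y) (permutations n)

  ∏Below-insert : ∀ {n} (j : Fin (suc n)) (π : Permutation′ n) p (y : Vector Carrier (suc n)) →
    ∏Below (insert zero j π) p y ≈
      (if toℕ j <ᵇ p then y zero else 1#) * ∏Below π (if toℕ j <ᵇ p then ℕ.pred p else p) (tail y)
  ∏Below-insert j π p y = *-congˡ (∏-cong λ k → reflexive (≡.cong (λ b → if b then y (suc k) else 1#)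
    (≡.trans (≡.cong (λ i → toℕ i <ᵇ p) (insert-punchIn zero j π k)) (punchIn-<ᵇ j (π ⟨$⟩ʳ k) p))))

  S-insert : ∀ {n} p (y : Vector Carrier (suc n)) →
    S p y ≈ ∑ λ (j : Fin (suc n)) → if toℕ j <ᵇ p then y zero * S (ℕ.pred p) (tail y) else S p (tail y)
  S-insert {n} p y = trans (∑Permutations-suc n _) (sum-cong-≋ summand)
    where
    select : ∀ b → ∑Permutations n (λ π → (if b then y zero else 1#) * ∏Below π (if b then ℕ.pred p else p) (tail y))
                   ≈ (if b then y zero * S (ℕ.pred p) (tail y) else S p (tail y))
    select true  = ∑ᴸ-*ˡ (y zero) (λ π → ∏Below π (ℕ.pred p) (tail y)) (permutations n)
    select false = ∑ᴸ-cong (λ π → *-identityˡ (∏Below π p (tail y))) (permutations n)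
    summand : ∀ (j : Fin (suc n)) → ∑Permutations n (λ π → ∏Below (insert zero j π) p y) ≈
                (if toℕ j <ᵇ p then y zero * S (ℕ.pred p) (tail y) else S p (tail y))
    summand j = trans (∑ᴸ-cong (λ π → ∏Below-insert j π p y) (permutations n)) (select (toℕ j <ᵇ p))

  -- Of the `suc n` images of coordinate 0, `p` lie below the threshold and contribute its factor;
  -- the others contribute 1. At `p = 0` the truncated `ℕ.pred p` comes with coefficient 0.
  S-suc : ∀ {n p} (y : Vector Carrier (suc n)) → p ℕ.≤ suc n →
    S p y ≈ fromℕ p * (y zero * S (ℕ.pred p) (tail y)) + fromℕ (suc n ∸ p) * S p (tail y)
  S-suc {n} {p} y p≤1+n = trans (S-insert p y) (∑-threshold _ _ p≤1+n)

  -- Bounds for the sums `S`.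

  fromℕ-! : ∀ n → fromℕ (suc n !) ≈ fromℕ (suc n) * fromℕ (n !)
  fromℕ-! n = ×1-homo-* (suc n) (n !)

  suc∸≢0⇒≤ : ∀ n p → suc n ∸ p ≡.≢ 0 → p ℕ.≤ n
  suc∸≢0⇒≤ n p ≢0 = ℕ.s≤s⁻¹ (ℕ.≰⇒> (≢0 ∘ ℕ.m≤n⇒m∸n≡0))

  -- Maclaurin's inequality for eₚ.
  S-≤-mean : ∀ {n p m} {y : Vector Carrier n} → p ℕ.≤ n → (∀ i → 0# ≤ y i) → 0# ≤ m →
             fromℕ n * m ≈ ∑ y → S p y ≤ fromℕ (n !) * m ^ p
  S-≤-mean {zero}  {zero}  _ _ _ _ = ≤-reflexive (sym (*-identityʳ _))
  S-≤-mean {suc n} {p} {m} {y} p≤1+n 0≤y 0≤m mean = begin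
    S p y ≈⟨ S-suc y p≤1+n ⟩
    fromℕ p * (y zero * S (ℕ.pred p) (tail y)) + fromℕ (suc n ∸ p) * S p (tail y)
      ≤⟨ +-mono-≤
          (*-monoˡ-≤ (fromℕ-nonNeg p) (*-monoˡ-≤ (0≤y zero) (S-≤-mean {n} (ℕ.pred-mono-≤ p≤1+n) (0≤y ∘ suc) 0≤m′ mean′)))
          (fromℕ-*-mono-≤ (suc n ∸ p) λ ≢0 → S-≤-mean {n} (suc∸≢0⇒≤ n p ≢0) (0≤y ∘ suc) 0≤m′ mean′) ⟩
    fromℕ p * (y zero * (N! * m′ ^ ℕ.pred p)) + fromℕ (suc n ∸ p) * (N! * m′ ^ p)
      ≈⟨ solve 6 (λ P y F A T B → P :* (y :* (F :* A)) :+ T :* (F :* B) := F :* (P :* (y :* A) :+ T :* B)) refl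
           (fromℕ p) (y zero) N! (m′ ^ ℕ.pred p) (fromℕ (suc n ∸ p)) (m′ ^ p) ⟩
    N! * (fromℕ p * (y zero * m′ ^ ℕ.pred p) + fromℕ (suc n ∸ p) * m′ ^ p)
      ≤⟨ *-monoˡ-≤ (fromℕ-nonNeg (n !)) (mean-step-≤ p≤1+n 0≤m 0≤m′ (trans (+-congˡ mean′) (sym mean))) ⟩
    N! * (fromℕ (suc n) * m ^ p)
      ≈⟨ solve 3 (λ F N A → F :* (N :* A) := N :* F :* A) refl N! (fromℕ (suc n)) (m ^ p) ⟩
    fromℕ (suc n) * N! * m ^ p ≈⟨ *-congʳ (fromℕ-! n) ⟨
    fromℕ (suc n !) * m ^ p ∎
    where
    N! = fromℕ (n !)
    tailMean : ∀ {n} {z : Vector Carrier n} → (∀ i → 0# ≤ z i) → ∃ λ m′ → 0# ≤ m′ × fromℕ n * m′ ≈ ∑ z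
    -- Every number is a mean of the empty tail; 0 is nonnegative, as required.
    tailMean {zero}      _   = 0# , ≤-refl , zeroˡ 0#
    tailMean {suc n} {z} 0≤z = ∑ z / fromℕ (suc n)
      , *-nonNeg (∑-nonNeg 0≤z) (⁻¹-nonNeg (fromℕ-nonNeg (suc n)) (fromℕ≉0 (suc n)))
      , x*[y/x]≈y (∑ z) (fromℕ≉0 (suc n))
    m′    = proj₁ (tailMean (0≤y ∘ suc))
    0≤m′  = proj₁ (proj₂ (tailMean (0≤y ∘ suc)))
    mean′ = proj₂ (proj₂ (tailMean (0≤y ∘ suc)))

  -- The equality case of `S-≤-mean`: both terms of the recurrence are multiples of the same
  -- quantity, and their coefficients add up to the number of coordinates. It evaluates `S` at the
  -- equalised point defining `C`.
  S-const : ∀ {n p v} {y : Vector Carrier n} → p ℕ.≤ n → (∀ i → y i ≈ v) → S p y ≈ fromℕ (n !) * v ^ p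
  S-const {zero}  {zero} _ _ = sym (*-identityʳ _)
  S-const {suc n} {p} {v} {y} p≤1+n y≈v = begin-equality
    S p y ≈⟨ S-suc y p≤1+n ⟩
    fromℕ p * (y zero * S (ℕ.pred p) (tail y)) + fromℕ (suc n ∸ p) * S p (tail y)
      ≈⟨ +-cong (*-congˡ (*-cong (y≈v zero) (S-const {n} (ℕ.pred-mono-≤ p≤1+n) (y≈v ∘ suc))))
                (fromℕ-*-cong (suc n ∸ p) λ ≢0 → S-const {n} (suc∸≢0⇒≤ n p ≢0) (y≈v ∘ suc)) ⟩
    fromℕ p * (v * (N! * v ^ ℕ.pred p)) + fromℕ (suc n ∸ p) * (N! * v ^ p)
      ≈⟨ +-congʳ (step p) ⟩
    fromℕ p * (N! * v ^ p) + fromℕ (suc n ∸ p) * (N! * v ^ p)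
      ≈⟨ distribʳ _ _ _ ⟨
    (fromℕ p + fromℕ (suc n ∸ p)) * (N! * v ^ p)
      ≈⟨ *-congʳ (fromℕ-∸ p≤1+n) ⟨
    fromℕ (suc n) * (N! * v ^ p) ≈⟨ *-assoc _ _ _ ⟨
    fromℕ (suc n) * N! * v ^ p   ≈⟨ *-congʳ (fromℕ-! n) ⟨
    fromℕ (suc n !) * v ^ p      ∎
    where
    N! = fromℕ (n !)
    fromℕ-*-cong : ∀ t {x z} → (t ≡.≢ 0 → x ≈ z) → fromℕ t * x ≈ fromℕ t * z
    fromℕ-*-cong zero    {x} {z} _ = trans (zeroˡ x) (sym (zeroˡ z))
    fromℕ-*-cong (suc t) x≈z       = *-congˡ (x≈z λ ())
    -- Merging `v` with `v ^ ℕ.pred p` into `v ^ p` is legitimate only for `p > 0`; at 0 the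
    -- coefficient vanishes.
    step : ∀ p → fromℕ p * (v * (N! * v ^ ℕ.pred p)) ≈ fromℕ p * (N! * v ^ p)
    step zero    = trans (zeroˡ _) (sym (zeroˡ _))
    step (suc p) = *-congˡ (solve 3 (λ v F A → v :* (F :* A) := F :* (v :* A)) refl v N! (v ^ p))

  -- There are `n !` products, each at most 1; the recurrence does the counting.
  S-≤-! : ∀ {n p} {y : Vector Carrier n} → p ℕ.≤ n → (∀ i → 0# ≤ y i) → (∀ i → y i ≤ 1#) → S p y ≤ fromℕ (n !)
  S-≤-! {zero}  {zero} _ _ _ = ≤-refl
  S-≤-! {suc n} {p} {y} p≤1+n 0≤y y≤1 = begin
    S p y ≈⟨ S-suc y p≤1+n ⟩
    fromℕ p * (y zero * S (ℕ.pred p) (tail y)) + fromℕ (suc n ∸ p) * S p (tail y)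
      ≤⟨ +-mono-≤ (*-monoˡ-≤ (fromℕ-nonNeg p) (≤-trans (*-monoʳ-≤ (S-nonNeg (ℕ.pred p) (0≤y ∘ suc)) (y≤1 zero))
                      (*-monoˡ-≤ 0≤1 (S-≤-! {n} (ℕ.pred-mono-≤ p≤1+n) (0≤y ∘ suc) (y≤1 ∘ suc)))))
                  (fromℕ-*-mono-≤ (suc n ∸ p) λ ≢0 → S-≤-! {n} (suc∸≢0⇒≤ n p ≢0) (0≤y ∘ suc) (y≤1 ∘ suc)) ⟩
    fromℕ p * (1# * N!) + fromℕ (suc n ∸ p) * N!
      ≈⟨ solve 3 (λ P T F → P :* (con 1 :* F) :+ T :* F := (P :+ T) :* F) refl (fromℕ p) (fromℕ (suc n ∸ p)) N! ⟩
    (fromℕ p + fromℕ (suc n ∸ p)) * N! ≈⟨ *-congʳ (fromℕ-∸ p≤1+n) ⟨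
    fromℕ (suc n) * N!                 ≈⟨ fromℕ-! n ⟨
    fromℕ (suc n !)                    ∎
    where N! = fromℕ (n !)

  -- Only the permutations that send i₀ to one of the n + 1 - p values from p on contribute.
  S-≤-vanishing : ∀ {n p} {y : Vector Carrier (suc n)} (i₀ : Fin (suc n)) → p ℕ.≤ suc n → y i₀ ≈ 0# →
    (∀ i → 0# ≤ y i) → (∀ i → y i ≤ 1#) → S p y ≤ fromℕ (n !) * fromℕ (suc n ∸ p)
  S-≤-vanishing {n} {p} {y} zero p≤1+n y₀≈0 0≤y y≤1 = begin
    S p y ≈⟨ S-suc y p≤1+n ⟩
    fromℕ p * (y zero * S (ℕ.pred p) (tail y)) + fromℕ (suc n ∸ p) * S p (tail y)
      ≤⟨ +-mono-≤ (≤-reflexive (*-congˡ (*-congʳ y₀≈0)))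
                  (fromℕ-*-mono-≤ (suc n ∸ p) λ ≢0 → S-≤-! {n} (suc∸≢0⇒≤ n p ≢0) (0≤y ∘ suc) (y≤1 ∘ suc)) ⟩
    fromℕ p * (0# * S (ℕ.pred p) (tail y)) + fromℕ (suc n ∸ p) * N!
      ≈⟨ solve 4 (λ P A T F → P :* (con 0 :* A) :+ T :* F := F :* T) refl (fromℕ p) (S (ℕ.pred p) (tail y)) (fromℕ (suc n ∸ p)) N! ⟩
    N! * fromℕ (suc n ∸ p) ∎
    where N! = fromℕ (n !)
  S-≤-vanishing {suc n} {p} {y} (suc i₀) p≤2+n y₀≈0 0≤y y≤1 = begin
    S p y ≈⟨ S-suc y p≤2+n ⟩
    fromℕ p * (y zero * S (ℕ.pred p) (tail y)) + fromℕ (suc (suc n) ∸ p) * S p (tail y)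
      ≤⟨ +-mono-≤ (*-monoˡ-≤ (fromℕ-nonNeg p) (≤-trans (*-monoʳ-≤ (S-nonNeg (ℕ.pred p) (0≤y ∘ suc)) (y≤1 zero))
                      (*-monoˡ-≤ 0≤1 (S-≤-vanishing i₀ (ℕ.pred-mono-≤ p≤2+n) y₀≈0 (0≤y ∘ suc) (y≤1 ∘ suc)))))
                  (fromℕ-*-mono-≤ (suc (suc n) ∸ p) λ ≢0 → S-≤-vanishing i₀ (suc∸≢0⇒≤ (suc n) p ≢0) y₀≈0 (0≤y ∘ suc) (y≤1 ∘ suc)) ⟩
    fromℕ p * (1# * (N! * fromℕ (suc n ∸ ℕ.pred p))) + fromℕ (suc (suc n) ∸ p) * (N! * fromℕ (suc n ∸ p))
      ≈⟨ count p p≤2+n ⟩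
    fromℕ (suc n) * N! * fromℕ (suc (suc n) ∸ p) ≈⟨ *-congʳ (fromℕ-! n) ⟨
    fromℕ (suc n !) * fromℕ (suc (suc n) ∸ p) ∎
    where
    N! = fromℕ (n !)
    -- Both terms share the factor `n + 2 - p`, and `p + (n + 1 - p) = n + 1`.
    count : ∀ p → p ℕ.≤ suc (suc n) →
      fromℕ p * (1# * (N! * fromℕ (suc n ∸ ℕ.pred p))) + fromℕ (suc (suc n) ∸ p) * (N! * fromℕ (suc n ∸ p)) ≈
      fromℕ (suc n) * N! * fromℕ (suc (suc n) ∸ p)
    count zero    _ = solve 2 (λ N F →
      con 0 :* (con 1 :* (F :* N)) :+ (con 1 :+ N) :* (F :* N) := N :* F :* (con 1 :+ N)) refl (fromℕ (suc n)) N!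
    count (suc q) (ℕ.s≤s q≤1+n) = begin-equality
      (1# + Q) * (1# * (N! * T)) + T * (N! * fromℕ (n ∸ q))
        ≈⟨ solve 4 (λ Q F T U → (con 1 :+ Q) :* (con 1 :* (F :* T)) :+ T :* (F :* U) := (T :+ (T :* (Q :+ U))) :* F)
             refl Q N! T (fromℕ (n ∸ q)) ⟩
      (T + T * (Q + fromℕ (n ∸ q))) * N!
        ≈⟨ *-congʳ (+-congˡ (T*≈ (suc n ∸ q) ≡.refl)) ⟩
      (T + T * fromℕ n) * N!
        ≈⟨ solve 3 (λ T N F → (T :+ T :* N) :* F := (con 1 :+ N) :* F :* T) refl T (fromℕ n) N! ⟩
      fromℕ (suc n) * N! * T ∎
      where
      Q = fromℕ q
      T = fromℕ (suc n ∸ q)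
      -- At `q = suc n` the subtraction `n ∸ q` truncates and `q + (n ∸ q)` is not `n`, but then `T`
      -- is 0.
      T*≈ : ∀ t → suc n ∸ q ≡ t → fromℕ t * (Q + fromℕ (n ∸ q)) ≈ fromℕ t * fromℕ n
      T*≈ zero    _  = trans (zeroˡ _) (sym (zeroˡ _))
      T*≈ (suc t) eq = *-congˡ (sym (fromℕ-∸ (suc∸≢0⇒≤ n q (λ 0≡ → ℕ.0≢1+n (≡.trans (≡.sym 0≡) eq)))))

-- Sorting permutations by the positions of the two distinguished coordinates.

module Density {c ℓ₁ ℓ₂} (K : OrderedField c ℓ₁ ℓ₂) where
  open OrderedFieldProperties K
  open Simplex K
  open PermutationSums K
  open SemiringSum semiring using (sum-cong-≋; ∑-distrib-+; ∑-comm; *-distribˡ-sum; *-distribʳ-sum)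
  open Min totalOrder using (x≤y⇒x⊓y≈x; x≤y⇒y⊓x≈x; minOperator)
  open MinOp minOperator using (x⊓y≤y; ⊓-glb)

  -- The factor of S i r counts the ways to place the other distinguished
  -- coordinate, of weight u, before or after the given one, which has exactly
  -- i of the remaining n coordinates before it.
  G : ∀ {n} → Carrier → Vector Carrier n → Carrier
  G {n} u r = ∑ λ (i : Fin (suc n)) → (fromℕ (suc (toℕ i)) * u + fromℕ (suc n ∸ toℕ i)) * S (toℕ i) r

  -- A coordinate is not below its own position, so it contributes the factor 1 and leaves the
  -- threshold unchanged.
  ∏Below-insert-self : ∀ {n} (j : Fin (suc n)) (π : Permutation′ n) (y : Vector Carrier (suc n)) →
                       ∏Below (insert zero j π) (toℕ j) y ≈ ∏Below π (toℕ j) (tail y)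
  ∏Below-insert-self j π y = trans (∏Below-insert j π (toℕ j) y) (select (<ᵇ-irrefl (toℕ j)))
    where
    select : ∀ {b} → b ≡ false →
      (if b then y zero else 1#) * ∏Below π (if b then ℕ.pred (toℕ j) else toℕ j) (tail y) ≈ ∏Below π (toℕ j) (tail y)
    select ≡.refl = *-identityˡ _

  ∑∏Below-zero : ∀ {n} (y : Vector Carrier (2 ℕ+ n)) →
    ∑Permutations (2 ℕ+ n) (λ σ → ∏Below σ (toℕ (σ ⟨$⟩ʳ zero)) y) ≈ G (y (suc zero)) (tail (tail y))
  ∑∏Below-zero {n} y = begin-equality
    ∑Permutations (2 ℕ+ n) (λ σ → ∏Below σ (toℕ (σ ⟨$⟩ʳ zero)) y) ≈⟨ ∑Permutations-suc (suc n) _ ⟩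
    ∑ (λ j → ∑Permutations (suc n) λ π → ∏Below (insert zero j π) (toℕ j) y)
      ≈⟨ sum-cong-≋ (λ j → ∑ᴸ-cong (λ π → ∏Below-insert-self j π y) (permutations (suc n))) ⟩
    ∑ (λ (j : Fin (2 ℕ+ n)) → S (toℕ j) (tail y))
      ≈⟨ sum-cong-≋ (λ (j : Fin (2 ℕ+ n)) → S-suc (tail y) (toℕ≤pred[n] j)) ⟩
    ∑ (λ (j : Fin (2 ℕ+ n)) → before (toℕ j) + after (toℕ j))
      ≈⟨ ∑-distrib-+ {2 ℕ+ n} (before ∘ toℕ) (after ∘ toℕ) ⟩
    ∑ {2 ℕ+ n} (before ∘ toℕ) + ∑ {2 ℕ+ n} (after ∘ toℕ)
      -- `before` vanishes at 0 and `after` at `suc n`. Dropping these ends and shifting `before` by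
      -- one makes both sums run over the number of remaining coordinates below the threshold.
      ≈⟨ +-cong (trans (+-congʳ (zeroˡ _)) (+-identityˡ _)) (∑-dropLast (suc n) after after-last) ⟩
    ∑ {suc n} (before ∘ suc ∘ toℕ) + ∑ {suc n} (after ∘ toℕ)
      ≈⟨ ∑-distrib-+ {suc n} (before ∘ suc ∘ toℕ) (after ∘ toℕ) ⟨
    ∑ (λ (i : Fin (suc n)) → before (suc (toℕ i)) + after (toℕ i))
      ≈⟨ sum-cong-≋ (λ (i : Fin (suc n)) → solve 4 (λ I u A N → I :* (u :* A) :+ N :* A := (I :* u :+ N) :* A) refl
           (fromℕ (suc (toℕ i))) u (S (toℕ i) r) (fromℕ (suc n ∸ toℕ i))) ⟩
    G u r ∎
    where
    u = y (suc zero)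
    r = tail (tail y)
    before after : ℕ → Carrier
    before p = fromℕ p * (u * S (ℕ.pred p) r)
    after  p = fromℕ (suc n ∸ p) * S p r
    after-last : after (suc n) ≈ 0#
    after-last = trans (*-congʳ (reflexive (≡.cong fromℕ (ℕ.n∸n≡0 n)))) (zeroˡ _)

  -- The list of permutations is built from the image of coordinate 0, so the symmetry with
  -- `∑∏Below-zero` is not immediate. Here coordinate 0 is removed at position `j`, then the
  -- reference coordinate at position `i`.
  ∑∏Below-one : ∀ {n} (y : Vector Carrier (2 ℕ+ n)) →
    ∑Permutations (2 ℕ+ n) (λ σ → ∏Below σ (toℕ (σ ⟨$⟩ʳ suc zero)) y) ≈ G (y zero) (tail (tail y))
  ∑∏Below-one {n} y = begin-equality
    ∑Permutations (2 ℕ+ n) (λ σ → ∏Below σ (toℕ (σ ⟨$⟩ʳ suc zero)) y) ≈⟨ ∑Permutations-suc (suc n) _ ⟩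
    ∑ (λ j → ∑Permutations (suc n) λ π → ∏Below (insert zero j π) (toℕ (insert zero j π ⟨$⟩ʳ suc zero)) y)
      ≈⟨ sum-cong-≋ (λ (j : Fin (2 ℕ+ n)) → ∑Permutations-suc n (∏BelowOne j)) ⟩
    ∑ (λ j → ∑ λ i → ∑Permutations n λ ρ →
        ∏Below (insert zero j (insert zero i ρ)) (toℕ (insert zero j (insert zero i ρ) ⟨$⟩ʳ suc zero)) y)
      ≈⟨ sum-cong-≋ (λ j → sum-cong-≋ λ i → trans (∑ᴸ-cong (insert-two j i) (permutations n)) (∑ᴸ-*ˡ _ _ (permutations n))) ⟩
    ∑ (λ (j : Fin (2 ℕ+ n)) → ∑ λ (i : Fin (suc n)) → weight j i * S (toℕ i) r)
      -- At fixed `i`, the `suc i` positions `j ≤ i` put coordinate 0 before the reference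
      -- coordinate and carry the weight `y zero`.
      ≈⟨ ∑-comm {2 ℕ+ n} {suc n} (λ j i → weight j i * S (toℕ i) r) ⟩
    ∑ (λ (i : Fin (suc n)) → ∑ λ (j : Fin (2 ℕ+ n)) → weight j i * S (toℕ i) r)
      ≈⟨ sum-cong-≋ (λ i → *-distribʳ-sum {2 ℕ+ n} (S (toℕ i) r) (λ j → weight j i)) ⟨
    ∑ (λ (i : Fin (suc n)) → ∑ {2 ℕ+ n} (λ j → weight j i) * S (toℕ i) r)
      ≈⟨ sum-cong-≋ (λ (i : Fin (suc n)) → *-congʳ {S (toℕ i) r}
           (trans (∑-threshold (y zero) 1# (ℕ.s≤s (ℕ.m≤n⇒m≤1+n (toℕ≤pred[n] i)))) (+-congˡ (*-identityʳ _)))) ⟩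
    G (y zero) r ∎
    where
    r = tail (tail y)
    weight : Fin (2 ℕ+ n) → Fin (suc n) → Carrier
    weight j i = if toℕ j <ᵇ suc (toℕ i) then y zero else 1#
    ∏BelowOne : Fin (2 ℕ+ n) → Permutation′ (suc n) → Carrier
    ∏BelowOne j π = ∏Below (insert zero j π) (toℕ (insert zero j π ⟨$⟩ʳ suc zero)) y
    insert-two : ∀ j i ρ →
      ∏Below (insert zero j (insert zero i ρ)) (toℕ (insert zero j (insert zero i ρ) ⟨$⟩ʳ suc zero)) y ≈
      weight j i * ∏Below ρ (toℕ i) r
    insert-two j i ρ = begin-equality
      ∏Below (insert zero j π) (toℕ (insert zero j π ⟨$⟩ʳ suc zero)) y
        ≈⟨ ∏Below-insert j π (toℕ (punchIn j i)) y ⟩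
      (if toℕ j <ᵇ toℕ (punchIn j i) then y zero else 1#) *
        ∏Below π (if toℕ j <ᵇ toℕ (punchIn j i) then ℕ.pred (toℕ (punchIn j i)) else toℕ (punchIn j i)) (tail y)
        ≈⟨ *-cong (reflexive (≡.cong (λ b → if b then y zero else 1#) (<ᵇ-punchIn j i)))
                  (reflexive (≡.cong (λ p → ∏Below π p (tail y)) (lower-punchIn j i))) ⟩
      weight j i * ∏Below π (toℕ i) (tail y) ≈⟨ *-congˡ (∏Below-insert-self i ρ (tail y)) ⟩
      weight j i * ∏Below ρ (toℕ i) r ∎
      where π = insert zero i ρ

  -- Comparison of the sums `G`.

  G-mono-≤ : ∀ {n u} {r r′ : Vector Carrier n} → 0# ≤ u →
             (∀ {p} → p ℕ.≤ n → S p r ≤ S p r′) → G u r ≤ G u r′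
  G-mono-≤ {n} 0≤u S≤S = ∑-mono-≤ λ (i : Fin (suc n)) →
    *-monoˡ-≤ (+-nonNeg (*-nonNeg (fromℕ-nonNeg (suc (toℕ i))) 0≤u) (fromℕ-nonNeg (suc n ∸ toℕ i)))
              (S≤S (toℕ≤pred[n] i))

  -- The shift s makes the sum amenable to induction on n.
  tetrahedral : ∀ n s u →
    fromℕ 6 * ∑ (λ (i : Fin (suc n)) → ((fromℕ (suc (toℕ i)) + s) * u + fromℕ (suc n ∸ toℕ i)) * fromℕ (n ∸ toℕ i)) ≈
    fromℕ n * fromℕ (1 ℕ+ n) * (fromℕ (2 ℕ+ n) * (u + fromℕ 2) + fromℕ 3 * s * u)
  tetrahedral zero s u = solve 2 (λ s u →
    lit 6 :* (((con 1 :+ con 0 :+ s) :* u :+ (con 1 :+ con 0)) :* con 0 :+ con 0) :=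
    con 0 :* (con 1 :+ con 0) :* ((con 1 :+ (con 1 :+ con 0)) :* (u :+ lit 2) :+ lit 3 :* s :* u)) refl s u
  tetrahedral (suc n) s u = begin-equality
    fromℕ 6 * (((1# + 0# + s) * u + (1# + (1# + N))) * (1# + N) + ∑ (λ (i : Fin (suc n)) →
      ((fromℕ (2 ℕ+ toℕ i) + s) * u + fromℕ (suc n ∸ toℕ i)) * fromℕ (n ∸ toℕ i)))
      ≈⟨ *-congˡ (+-congˡ (sum-cong-≋ λ (i : Fin (suc n)) → solve 5 (λ I s u a b →
           ((con 1 :+ I :+ s) :* u :+ a) :* b := ((I :+ (con 1 :+ s)) :* u :+ a) :* b) refl
           (fromℕ (suc (toℕ i))) s u (fromℕ (suc n ∸ toℕ i)) (fromℕ (n ∸ toℕ i)))) ⟩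
    fromℕ 6 * (((1# + 0# + s) * u + (1# + (1# + N))) * (1# + N) + rest) ≈⟨ distribˡ _ _ _ ⟩
    fromℕ 6 * (((1# + 0# + s) * u + (1# + (1# + N))) * (1# + N)) + fromℕ 6 * rest
      ≈⟨ +-congˡ (tetrahedral n (1# + s) u) ⟩
    fromℕ 6 * (((1# + 0# + s) * u + (1# + (1# + N))) * (1# + N))
      + N * (1# + N) * ((1# + (1# + N)) * (u + fromℕ 2) + fromℕ 3 * (1# + s) * u)
      ≈⟨ solve 3 (λ s u N →
           lit 6 :* (((con 1 :+ con 0 :+ s) :* u :+ (con 1 :+ (con 1 :+ N))) :* (con 1 :+ N))
             :+ N :* (con 1 :+ N) :* ((con 1 :+ (con 1 :+ N)) :* (u :+ lit 2) :+ lit 3 :* (con 1 :+ s) :* u) :=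
           (con 1 :+ N) :* (con 1 :+ (con 1 :+ N)) :*
             ((con 1 :+ (con 1 :+ (con 1 :+ N))) :* (u :+ lit 2) :+ lit 3 :* s :* u)) refl s u N ⟩
    (1# + N) * (1# + (1# + N)) * ((1# + (1# + (1# + N))) * (u + fromℕ 2) + fromℕ 3 * s * u) ∎
    where
    N = fromℕ n
    rest = ∑ λ (i : Fin (suc n)) → ((fromℕ (suc (toℕ i)) + (1# + s)) * u + fromℕ (suc n ∸ toℕ i)) * fromℕ (n ∸ toℕ i)

  -- Bounding each `S` by `S-≤-vanishing` leaves the sum evaluated by `tetrahedral` at shift 0. Here
  -- 6 is `3 !` and `u + 2` is the value of `G` at a single vanishing coordinate, so this is the
  -- cross-multiplied comparison with `k = 3`.
  G-≤-vanishing : ∀ {n u} {r : Vector Carrier (suc n)} (i₀ : Fin (suc n)) → 0# ≤ u → r i₀ ≈ 0# →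
    (∀ i → 0# ≤ r i) → (∀ i → r i ≤ 1#) → fromℕ 6 * G u r ≤ fromℕ ((3 ℕ+ n) !) * (u + fromℕ 2)
  G-≤-vanishing {n} {u} {r} i₀ 0≤u r₀≈0 0≤r r≤1 = begin
    fromℕ 6 * G u r ≤⟨ *-monoˡ-≤ (fromℕ-nonNeg 6) (∑-mono-≤ λ (i : Fin (2 ℕ+ n)) →
        *-monoˡ-≤ (+-nonNeg (*-nonNeg (fromℕ-nonNeg (suc (toℕ i))) 0≤u) (fromℕ-nonNeg (2 ℕ+ n ∸ toℕ i)))
                  (S-≤-vanishing i₀ (toℕ≤pred[n] i) r₀≈0 0≤r r≤1)) ⟩
    fromℕ 6 * ∑ (λ (i : Fin (2 ℕ+ n)) →
      (fromℕ (suc (toℕ i)) * u + fromℕ (2 ℕ+ n ∸ toℕ i)) * (N! * fromℕ (suc n ∸ toℕ i)))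
      ≈⟨ *-congˡ (sum-cong-≋ λ (i : Fin (2 ℕ+ n)) → solve 5 (λ I u J F T →
           (I :* u :+ J) :* (F :* T) := F :* (((I :+ con 0) :* u :+ J) :* T)) refl
           (fromℕ (suc (toℕ i))) u (fromℕ (2 ℕ+ n ∸ toℕ i)) N! (fromℕ (suc n ∸ toℕ i))) ⟩
    fromℕ 6 * ∑ (λ (i : Fin (2 ℕ+ n)) → N! * summand i) ≈⟨ *-congˡ (*-distribˡ-sum {2 ℕ+ n} N! summand) ⟨
    fromℕ 6 * (N! * ∑ summand)    ≈⟨ solve 3 (λ a b c → a :* (b :* c) := b :* (a :* c)) refl (fromℕ 6) N! (∑ summand) ⟩
    N! * (fromℕ 6 * ∑ summand)    ≈⟨ *-congˡ (tetrahedral (suc n) 0# u) ⟩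
    N! * (fromℕ (1 ℕ+ n) * fromℕ (2 ℕ+ n) * (fromℕ (3 ℕ+ n) * (u + fromℕ 2) + fromℕ 3 * 0# * u))
      ≈⟨ solve 6 (λ F a b c v w → F :* (a :* b :* (c :* v :+ lit 3 :* con 0 :* w)) := c :* (b :* (a :* F)) :* v) refl
           N! (fromℕ (1 ℕ+ n)) (fromℕ (2 ℕ+ n)) (fromℕ (3 ℕ+ n)) (u + fromℕ 2) u ⟩
    fromℕ (3 ℕ+ n) * (fromℕ (2 ℕ+ n) * (fromℕ (1 ℕ+ n) * N!)) * (u + fromℕ 2)
      ≈⟨ *-congʳ (trans (fromℕ-! (2 ℕ+ n)) (*-congˡ (trans (fromℕ-! (1 ℕ+ n)) (*-congˡ (fromℕ-! n))))) ⟨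
    fromℕ ((3 ℕ+ n) !) * (u + fromℕ 2) ∎
    where
    N! = fromℕ (n !)
    summand : Fin (2 ℕ+ n) → Carrier
    summand i = ((fromℕ (suc (toℕ i)) + 0#) * u + fromℕ (2 ℕ+ n ∸ toℕ i)) * fromℕ (suc n ∸ toℕ i)

  -- Only the term with threshold 0 survives: for threshold 1 the product is the vanishing
  -- coordinate itself.
  G-singleton-zero : ∀ {u} {r : Vector Carrier 1} → r zero ≈ 0# → G u r ≈ u + fromℕ 2
  G-singleton-zero {u} {r} r₀≈0 = begin-equality
    G u r ≈⟨ +-cong (*-congˡ (S-const {1} ℕ.z≤n r≈0)) (+-congʳ (*-congˡ (S-const {1} (ℕ.s≤s ℕ.z≤n) r≈0))) ⟩
    ((1# + 0#) * u + fromℕ 2) * ((1# + 0#) * 1#) + ((fromℕ 2 * u + (1# + 0#)) * ((1# + 0#) * (0# * 1#)) + 0#)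
      ≈⟨ solve 1 (λ u → ((con 1 :+ con 0) :* u :+ lit 2) :* ((con 1 :+ con 0) :* con 1)
           :+ ((lit 2 :* u :+ (con 1 :+ con 0)) :* ((con 1 :+ con 0) :* (con 0 :* con 1)) :+ con 0) := u :+ lit 2) refl u ⟩
    u + fromℕ 2 ∎
    where
    r≈0 : ∀ i → r i ≈ 0#
    r≈0 zero = r₀≈0

  -- The function `F` and the reduction of `d` to `G`.

  0≤11/6 : 0# ≤ 11/6
  0≤11/6 = *-nonNeg (fromℕ-nonNeg 11) (⁻¹-nonNeg (fromℕ-nonNeg 6) (fromℕ≉0 6))

  11/6*6/11≈1 : 11/6 * 6/11 ≈ 1#
  11/6*6/11≈1 = begin-equality
    fromℕ 11 * fromℕ 6 ⁻¹ * (fromℕ 6 * fromℕ 11 ⁻¹)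
      ≈⟨ solve 4 (λ a b c d → a :* b :* (c :* d) := (a :* d) :* (c :* b)) refl (fromℕ 11) (fromℕ 6 ⁻¹) (fromℕ 6) (fromℕ 11 ⁻¹) ⟩
    fromℕ 11 * fromℕ 11 ⁻¹ * (fromℕ 6 * fromℕ 6 ⁻¹)
      ≈⟨ *-cong (⁻¹-inverseʳ (fromℕ 11) (fromℕ≉0 11)) (⁻¹-inverseʳ (fromℕ 6) (fromℕ≉0 6)) ⟩
    1# * 1# ≈⟨ *-identityˡ 1# ⟩
    1#      ∎

  F-linear : ∀ {z} → z ≤ 6/11 → F z ≈ 11/6 * z
  F-linear z≤6/11 = x≤y⇒x⊓y≈x (≤-respʳ-≈ 11/6*6/11≈1 (*-monoˡ-≤ 0≤11/6 z≤6/11))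

  F-saturated : ∀ {z} → 6/11 ≤ z → F z ≈ 1#
  F-saturated 6/11≤z = x≤y⇒y⊓x≈x (≤-respˡ-≈ 11/6*6/11≈1 (*-monoˡ-≤ 0≤11/6 6/11≤z))

  0≤F′ : ∀ z → 0# ≤ F′ z
  0≤F′ z with does ((0# ≤? z) ×-dec (z ≤? 6/11))
  ... | true  = 0≤11/6
  ... | false = ≤-refl

  1-F : Carrier → Carrier
  1-F z = 1# - F z

  0≤1-F : ∀ z → 0# ≤ 1-F z
  0≤1-F z = x≤y⇒0≤y-x (x⊓y≤y (11/6 * z) 1#)

  1-F≤1 : ∀ {z} → 0# ≤ z → 1-F z ≤ 1#
  1-F≤1 0≤z = 0≤x⇒y-x≤y 1# (⊓-glb (*-nonNeg 0≤11/6 0≤z) 0≤1)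

  1-F-saturated : ∀ {z} → 6/11 ≤ z → 1-F z ≈ 0#
  1-F-saturated 6/11≤z = trans (+-congˡ (-‿cong (F-saturated 6/11≤z))) (-‿inverseʳ 1#)

  d-G : ∀ {n} (x : Vector Carrier (2 ℕ+ n)) → let r = 1-F ∘ tail (tail x); p = 1# / fromℕ ((2 ℕ+ n) !) in
        d x ≈ F′ (x zero) * (p * G (1-F (x (suc zero))) r) + F′ (x (suc zero)) * (p * G (1-F (x zero)) r)
  d-G {n} x = begin-equality
    p * ∑Permutations k (λ σ → a * A σ + b * B σ)
      ≈⟨ *-congˡ (∑ᴸ-+ (λ σ → a * A σ) (λ σ → b * B σ) (permutations k)) ⟩
    p * (∑Permutations k (λ σ → a * A σ) + ∑Permutations k (λ σ → b * B σ))
      ≈⟨ *-congˡ (+-cong (∑ᴸ-*ˡ a A (permutations k)) (∑ᴸ-*ˡ b B (permutations k))) ⟩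
    p * (a * ∑Permutations k A + b * ∑Permutations k B)
      -- No conversion from `∏Before` to `∏Below` is written out, since the boolean tests in both
      -- compute to the same comparison.
      ≈⟨ *-congˡ (+-cong (*-congˡ (∑∏Below-zero (1-F ∘ x))) (*-congˡ (∑∏Below-one (1-F ∘ x)))) ⟩
    p * (a * G (1-F (x (suc zero))) r + b * G (1-F (x zero)) r)
      ≈⟨ solve 5 (λ p a b A B → p :* (a :* A :+ b :* B) := a :* (p :* A) :+ b :* (p :* B)) refl p a b _ _ ⟩
    a * (p * G (1-F (x (suc zero))) r) + b * (p * G (1-F (x zero)) r) ∎
    where
    k = 2 ℕ+ n
    p = 1# / fromℕ (k !)
    r = 1-F ∘ tail (tail x)
    a = F′ (x zero)
    b = F′ (x (suc zero))
    A B : Permutation′ k → Carrier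
    A σ = ∏Before σ zero x
    B σ = ∏Before σ (suc zero) x

  -- Both points share their first two coordinates, hence the nonnegative factors `F′` and the
  -- weights `u`. A comparison of the normalised `G` uniform in `u` therefore suffices, even across
  -- different numbers of coordinates.
  d-mono-≤ : ∀ {n n′} (x : Vector Carrier (2 ℕ+ n)) (r : Vector Carrier n′) →
    (∀ {u} → 0# ≤ u → (1# / fromℕ ((2 ℕ+ n) !)) * G u (1-F ∘ tail (tail x)) ≤ (1# / fromℕ ((2 ℕ+ n′) !)) * G u (1-F ∘ r)) →
    d x ≤ d (x zero ∷ᵛ x (suc zero) ∷ᵛ r)
  d-mono-≤ x r G≤G = begin
    d x   ≈⟨ d-G x ⟩
    _     ≤⟨ +-mono-≤ (*-monoˡ-≤ (0≤F′ (x zero)) (G≤G (0≤1-F (x (suc zero)))))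
                      (*-monoˡ-≤ (0≤F′ (x (suc zero))) (G≤G (0≤1-F (x zero)))) ⟩
    _     ≈⟨ d-G (x zero ∷ᵛ x (suc zero) ∷ᵛ r) ⟨
    d (x zero ∷ᵛ x (suc zero) ∷ᵛ r) ∎

  -- The two cases of the bound.

  module _ (m : ℕ) (x : Vector Carrier (3 ℕ+ m)) (x∈Δ : InSimplex x) where
    private
      n = 1 ℕ+ m
      N = fromℕ n
      x₁ = x zero
      x₂ = x (suc zero)
      r : Vector Carrier n
      r = tail (tail x)
      0≤r : ∀ i → 0# ≤ r i
      0≤r i = proj₁ x∈Δ (suc (suc i))

      ∑r≈1-x₁-x₂ : ∑ r ≈ 1# - x₁ - x₂
      ∑r≈1-x₁-x₂ = +-cancelʳ x₂ _ _ (+-cancelʳ x₁ _ _ (begin-equality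
        ∑ r + x₂ + x₁               ≈⟨ solve 3 (λ a b c → a :+ b :+ c := c :+ (b :+ a)) refl (∑ r) x₂ x₁ ⟩
        x₁ + (x₂ + ∑ r)             ≈⟨ proj₂ x∈Δ ⟩
        1#                          ≈⟨ x+y-x≈y x₁ 1# ⟨
        x₁ + (1# - x₁)              ≈⟨ +-congˡ (x+y-x≈y x₂ (1# - x₁)) ⟨
        x₁ + (x₂ + (1# - x₁ - x₂))  ≈⟨ solve 3 (λ a b c → a :+ b :+ c := c :+ (b :+ a)) refl _ x₂ x₁ ⟨
        (1# - x₁ - x₂) + x₂ + x₁    ∎))

    d-≤-C : (∀ i → r i ≤ 6/11) → d x ≤ C m x₁ x₂
    d-≤-C r≤6/11 = d-mono-≤ x (replicate n c′) λ 0≤u →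
      *-monoˡ-≤ (*-nonNeg 0≤1 (⁻¹-nonNeg (fromℕ-nonNeg ((2 ℕ+ n) !)) (fromℕ≉0 ((2 ℕ+ n) !) {{(2 ℕ+ n) ℕ.!≢0}})))
        (G-mono-≤ {r = 1-F ∘ r} {1-F ∘ replicate n c′} 0≤u λ p≤n → ≤-trans
          (S-≤-mean p≤n (λ i → 0≤1-F (r i)) (0≤1-F c′) mean)
          (≤-reflexive (sym (S-const {n} p≤n λ _ → refl))))
      where
      c′ = (1# - x₁ - x₂) / N
      N*c′≈∑r : N * c′ ≈ ∑ r
      N*c′≈∑r = trans (x*[y/x]≈y _ (fromℕ≉0 n)) (sym ∑r≈1-x₁-x₂)
      -- As the mean of `r`, the point `c′` also lies where `F` is linear.
      c′≤6/11 : c′ ≤ 6/11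
      c′≤6/11 = *-cancelˡ-≤ (fromℕ-nonNeg n) (fromℕ≉0 n) (begin
        N * c′                ≈⟨ N*c′≈∑r ⟩
        ∑ r                   ≤⟨ ∑-mono-≤ r≤6/11 ⟩
        ∑ (replicate n 6/11)  ≈⟨ ∑-replicate n 6/11 ⟩
        N * 6/11              ∎)
      complement : ∀ {k} (z : Vector Carrier k) → ∑ (1-F ∘ z) + ∑ (F ∘ z) ≈ fromℕ k
      complement {k} z = begin-equality
        ∑ (1-F ∘ z) + ∑ (F ∘ z)   ≈⟨ ∑-distrib-+ {k} (1-F ∘ z) (F ∘ z) ⟨
        ∑ (λ i → 1-F (z i) + F (z i)) ≈⟨ sum-cong-≋ (λ i → trans (+-comm _ _) (x+y-x≈y (F (z i)) 1#)) ⟩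
        ∑ (replicate k 1#)        ≈⟨ ∑-replicate k 1# ⟩
        fromℕ k * 1#              ≈⟨ *-identityʳ _ ⟩
        fromℕ k                   ∎
      -- An affine function maps the mean of `r` to the mean of its values. Adding `∑ (F ∘ r)` to
      -- both sides keeps the computation free of subtraction.
      mean : N * 1-F c′ ≈ ∑ (1-F ∘ r)
      mean = +-cancelʳ (∑ (F ∘ r)) _ _ (begin-equality
        N * 1-F c′ + ∑ (F ∘ r) ≈⟨ +-congˡ (sum-cong-≋ λ i → F-linear (r≤6/11 i)) ⟩
        N * 1-F c′ + ∑ (λ i → 11/6 * r i) ≈⟨ +-congˡ (*-distribˡ-sum 11/6 r) ⟨
        N * 1-F c′ + 11/6 * ∑ r      ≈⟨ +-congˡ (*-congˡ N*c′≈∑r) ⟨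
        N * 1-F c′ + 11/6 * (N * c′) ≈⟨ solve 4 (λ N a b c → N :* a :+ b :* (N :* c) := N :* (b :* c :+ a)) refl N (1-F c′) 11/6 c′ ⟩
        N * (11/6 * c′ + 1-F c′)     ≈⟨ *-congˡ (+-congʳ (F-linear c′≤6/11)) ⟨
        N * (F c′ + 1-F c′)          ≈⟨ *-congˡ (x+y-x≈y (F c′) 1#) ⟩
        N * 1#                       ≈⟨ *-identityʳ N ⟩
        N                            ≈⟨ complement r ⟨
        ∑ (1-F ∘ r) + ∑ (F ∘ r)      ∎)

    d-≤-C₃ : (∃ λ i → 6/11 ≤ r i) → d x ≤ C 0 x₁ x₂
    d-≤-C₃ (i₀ , 6/11≤rᵢ) = d-mono-≤ x (replicate 1 c′) λ {u} 0≤u →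
      -- The 6 is the computed value of `3 !`, the normalisation in `C 0`.
      reciprocal-*-mono-≤ (fromℕ-nonNeg ((3 ℕ+ m) !)) (fromℕ≉0 ((3 ℕ+ m) !) {{(3 ℕ+ m) ℕ.!≢0}}) (fromℕ-nonNeg 6) (fromℕ≉0 6) (begin
        fromℕ 6 * G u (1-F ∘ r) ≤⟨ G-≤-vanishing i₀ 0≤u (1-F-saturated 6/11≤rᵢ) (λ i → 0≤1-F (r i)) (λ i → 1-F≤1 (0≤r i)) ⟩
        fromℕ ((3 ℕ+ m) !) * (u + fromℕ 2) ≈⟨ *-congˡ (G-singleton-zero {r = 1-F ∘ replicate 1 c′} (1-F-saturated 6/11≤c′)) ⟨
        fromℕ ((3 ℕ+ m) !) * G u (1-F ∘ replicate 1 c′) ∎)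
      where
      c′ = (1# - x₁ - x₂) / fromℕ 1
      ≤-∑ : ∀ {k} (z : Vector Carrier k) → (∀ i → 0# ≤ z i) → ∀ i → z i ≤ ∑ z
      ≤-∑ z 0≤z zero    = 0≤x⇒y≤y+x (z zero) (∑-nonNeg (0≤z ∘ suc))
      ≤-∑ z 0≤z (suc i) = ≤-trans (≤-∑ (tail z) (0≤z ∘ suc) i) (≤-respʳ-≈ (+-comm _ _) (0≤x⇒y≤y+x (∑ (tail z)) (0≤z zero)))
      -- For `k = 3` the single remaining coordinate carries the whole sum of `r`, which is at least
      -- `r i₀`; so `1-F` vanishes there too.
      6/11≤c′ : 6/11 ≤ c′
      6/11≤c′ = begin
        6/11              ≤⟨ 6/11≤rᵢ ⟩
        r i₀              ≤⟨ ≤-∑ r 0≤r i₀ ⟩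
        ∑ r               ≈⟨ ∑r≈1-x₁-x₂ ⟩
        1# - x₁ - x₂      ≈⟨ x*[y/x]≈y _ (fromℕ≉0 1) ⟨
        fromℕ 1 * c′      ≈⟨ *-congʳ (+-identityʳ 1#) ⟩
        1# * c′           ≈⟨ *-identityˡ c′ ⟩
        c′                ∎

lemma6p4 : ∀ {c ℓ₁ ℓ₂} (K : OrderedField c ℓ₁ ℓ₂) →
    let open OrderedField K
        open Simplex K
    in
    (m : ℕ) (x : Vector Carrier (3 ℕ+ m)) → InSimplex x →
      ((∀ (i : Fin (1 ℕ+ m)) → x (suc (suc i)) ≤ 6/11) →
        d x ≤ C m (x zero) (x (suc zero)))
    × ((∃ λ (i : Fin (1 ℕ+ m)) → 6/11 ≤ x (suc (suc i))) →
        d x ≤ C 0 (x zero) (x (suc zero)))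
lemma6p4 K m x x∈Δ = Density.d-≤-C K m x x∈Δ , Density.d-≤-C₃ K m x x∈Δ
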